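{- Let $\mathbb{P}=\varprojlim\langle\{P_n\},\{p^n_k\}_{k<n}\rangle$ where $\langle\{P_n\},\{p^n_k\}\rangle$ is a Fraïssé sequence in the category of finite posets with quotient maps. Let $A,B$ be finite posets (discrete topology), $f:\mathbb{P}\to A$ a continuous quotient map and $g:B\to A$ a quotient map. Then there is a continuous quotient map $h:\mathbb{P}\to B$ with $g\circ h=f$.
   Context: A quotient map between posets is a surjective order-preserving map $\phi:A\to B$ such that for all $p\le r$ in $B$ there are $x\le y$ in $A$ with $\phi(x)=p,\phi(y)=r$. The inverse limit of nonempty finite posets $P_n$ with quotient maps $p^m_k:P_m\to P_k$ ($k<m$, $p^k_l\circ p^m_k=p^m_l$) is $\{(x_n)\in\prod_nP_n:p^{n+1}_n(x_{n+1})=x_n\ \forall n\}$, ordered coordinatewise, with the subspace topology of the product of discrete spaces. The sequence is a Fraïssé sequence if (U) for every finite poset $X$ there are $n$ and a quotient map $P_n\to X$, and (A) for every $k$, every finite poset $Y$ and quotient map $f:Y\to P_k$ there exist $\ell>k$ and a quotient map $g:P_\ell\to Y$ with $f\circ g=p^\ell_k$. -}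

module Defs where

open import Level using (Level; 0ℓ; _⊔_) renaming (suc to lsuc)
open import Data.Fin.Base using (Fin)
open import Data.List.Base using (List)
open import Data.List.Relation.Unary.All using (All)
open import Data.Nat.Base using (ℕ; suc; _<_)
open import Data.Nat.Properties using (n<1+n; <-trans)
open import Data.Product using (Σ; ∃; ∃₂; _×_; _,_; proj₁)
open import Function.Bundles using (Inverse; _⇔_)
open import Function.Definitions using (Surjective)
open import Relation.Binary.Bundles using (Poset)
open import Relation.Binary.Definitions using (_Respects_)
open import Relation.Binary.Morphism.Structures using (IsOrderHomomorphism)
open import Relation.Binary.PropositionalEquality using (setoid)
open import Relation.Unary using (Pred; _⊢_)

open Poset using (Carrier)

-- Equality of elements of a poset is its setoid equality _≈_ throughout:
-- without function extensionality, equality in an inverse limit has to be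
-- taken coordinatewise.

Pos : Set₁
Pos = Poset 0ℓ 0ℓ 0ℓ

Finite : Pos → Set
Finite A = ∃ λ n → Inverse (setoid (Fin n)) (Poset.Eq.setoid A)

record IsQuotientMap (A B : Pos) (φ : Carrier A → Carrier B) : Set where
  private
    module A = Poset A
    module B = Poset B
  field
    isOrderHomomorphism : IsOrderHomomorphism A._≈_ B._≈_ A._≤_ B._≤_ φ
    surjective          : Surjective A._≈_ B._≈_ φ
    lifts-≤             : ∀ {p r} → p B.≤ r →
                          ∃₂ λ x y → x A.≤ y × φ x B.≈ p × φ y B.≈ r

record QuotientMap (A B : Pos) : Set where
  field
    ⟦_⟧           : Carrier A → Carrier B
    isQuotientMap : IsQuotientMap A B ⟦_⟧

open QuotientMap public using (⟦_⟧)

record InverseSequence : Set₁ where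
  field
    P        : ℕ → Pos
    finite   : ∀ n → Finite (P n)
    nonempty : ∀ n → Carrier (P n)
    p        : ∀ {k m} → k < m → QuotientMap (P m) (P k)
    p-comp   : ∀ {l k m} (l<k : l < k) (k<m : k < m) (x : Carrier (P m)) →
               Poset._≈_ (P l) (⟦ p l<k ⟧ (⟦ p k<m ⟧ x))
                               (⟦ p (<-trans l<k k<m) ⟧ x)

-- The objects of the category are the nonempty finite posets. This has to be
-- said in `universal`, since the empty poset is not a quotient of any P n; in
-- `amalgamation` the poset Y is nonempty because it maps onto P k.

record IsFraïssé (S : InverseSequence) : Set₁ where
  open InverseSequence S
  field
    universal    : (X : Pos) → Finite X → Carrier X →
                   ∃ λ n → QuotientMap (P n) X
    amalgamation : ∀ k (Y : Pos) → Finite Y → (f : QuotientMap Y (P k)) →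
                   ∃ λ l → Σ (k < l) λ k<l → Σ (QuotientMap (P l) Y) λ g →
                   ∀ x → Poset._≈_ (P k) (⟦ f ⟧ (⟦ g ⟧ x)) (⟦ p k<l ⟧ x)

-- A topology is given by its predicate of open sets.

Topology : Set → (ℓ : Level) → Set (lsuc 0ℓ ⊔ lsuc ℓ)
Topology X ℓ = Pred (Pred X 0ℓ) ℓ

-- Every subset is open; a subset of a setoid is a predicate respecting _≈_.

discrete : (A : Pos) → Topology (Carrier A) 0ℓ
discrete A U = U Respects Poset._≈_ A

product : ∀ {ℓ} {X : ℕ → Set} → (∀ n → Topology (X n) ℓ) →
          Topology (∀ n → X n) (lsuc 0ℓ ⊔ ℓ)
product {X = X} τ U =
  ∀ x → U x →
  ∃ λ (F : List ℕ) → Σ (∀ n → Pred (X n) 0ℓ) λ W →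
    (∀ n → τ n (W n)) ×
    All (λ n → W n (x n)) F ×
    (∀ y → All (λ n → W n (y n)) F → U y)

-- The subspace is presented by its inclusion ι.

subspace : ∀ {ℓ} {X Y : Set} → (X → Y) → Topology Y ℓ →
           Topology X (lsuc 0ℓ ⊔ ℓ)
subspace {Y = Y} ι τ U =
  Σ (Pred Y 0ℓ) λ V → τ V × (∀ x → U x ⇔ V (ι x))

-- Pointwise notion: that a continuous map from an inverse limit to a finite
-- discrete space factors through some P n is compactness, which is not
-- provable constructively. Statements about such maps assume excluded middle.

Continuous : ∀ {ℓ₁ ℓ₂} {X Y : Set} → Topology X ℓ₁ → Topology Y ℓ₂ →
             (X → Y) → Set (lsuc 0ℓ ⊔ ℓ₁ ⊔ ℓ₂)
Continuous τ σ f = ∀ U → σ U → τ (f ⊢ U)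

module _ (S : InverseSequence) where
  open InverseSequence S
  private module P n = Poset (P n)

  Thread : Set
  Thread = Σ (∀ n → P.Carrier n) λ x →
           ∀ n → P._≈_ n (⟦ p (n<1+n n) ⟧ (x (suc n))) (x n)

  limit : Pos
  limit = record
    { Carrier = Thread
    ; _≈_ = λ x y → ∀ n → P._≈_ n (proj₁ x n) (proj₁ y n)
    ; _≤_ = λ x y → ∀ n → P._≤_ n (proj₁ x n) (proj₁ y n)
    ; isPartialOrder = record
      { isPreorder = record
        { isEquivalence = record
          { refl  = λ n → P.Eq.refl n
          ; sym   = λ x≈y n → P.Eq.sym n (x≈y n)
          ; trans = λ x≈y y≈z n → P.Eq.trans n (x≈y n) (y≈z n)
          }
        ; reflexive = λ x≈y n → P.reflexive n (x≈y n)
        ; trans     = λ x≤y y≤z n → P.trans n (x≤y n) (y≤z n)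
        }
      ; antisym = λ x≤y y≤x n → P.antisym n (x≤y n) (y≤x n)
      }
    }

  limitTopology : Topology (Carrier limit) (lsuc 0ℓ)
  limitTopology = subspace proj₁ (product λ n → discrete (P n))

{-# OPTIONS --safe #-}
-- A map from the limit to a finite discrete poset is locally constant, so by
-- compactness (König's lemma) f = f′ ∘ π_N for the projection π_N onto some P N,
-- and f′ is again a quotient map. Let Y be the pullback of f′ and g, a finite
-- poset whose projections are quotient maps. Amalgamation gives k : P l → Y
-- lifting p : P l → P N along Y → P N, and h = (Y → B) ∘ k ∘ π_l.
module Submission where

open import Defs
open import Level using (0ℓ)
open import Axiom.ExcludedMiddle using (ExcludedMiddle)
open import Data.Empty using (⊥-elim)
open import Data.Fin.Base using (Fin; zero; suc)
open import Data.List.Base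
  using (List; []; _∷_; map; allFin; lookup; deduplicate; cartesianProduct)
open import Data.List.Extrema.Nat using (max; xs≤max)
open import Data.List.Membership.Propositional.Properties using (∈-lookup; ∈-allFin)
import Data.List.Membership.Setoid as Membership
open import Data.List.Relation.Unary.All as All using (All; []; _∷_)
open import Data.List.Relation.Unary.AllPairs using (_∷_)
open import Data.List.Relation.Unary.Any using (here; there)
open import Data.List.Relation.Unary.Enumerates.Setoid using (IsEnumeration)
import Data.List.Relation.Unary.Enumerates.Setoid.Properties as Enumerates
open import Data.List.Relation.Unary.Unique.DecSetoid.Properties using (deduplicate-!)
import Data.List.Relation.Unary.Unique.Setoid as Unique
open import Data.Nat.Base using (ℕ; zero; suc; _+_; _<_; _≤_; _⊔_; s≤s)
open import Data.Nat.Properties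
  using (n<1+n; <-trans; <-irrelevant; m<1+n⇒m<n∨m≡n; m≤n⇒m<n∨m≡n;
         m≤m⊔n; m≤n⊔m; m≤m+n; m≤n+m)
open import Data.Product using (Σ; ∃; _×_; _,_; proj₁; proj₂)
open import Data.Product.Relation.Binary.Pointwise.NonDependent using (×-poset)
open import Data.Sum.Base using (_⊎_; inj₁; inj₂)
open import Data.Unit.Base using (⊤; tt)
open import Function.Base using (_∘_)
open import Function.Bundles using (Bijection; Inverse; Equivalence; mk⇔)
open import Function.Properties.Bijection using (Bijection⇒Inverse)
open import Function.Properties.Inverse using (Inverse⇒Bijection)
open import Relation.Binary.Bundles using (Poset; Setoid; DecSetoid)
import Relation.Binary.Construct.On as On
open import Relation.Binary.Definitions using (_Respects_)
open import Relation.Binary.Morphism.Structures using (IsOrderHomomorphism)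
open import Relation.Binary.PropositionalEquality using (_≡_; refl; cong; setoid; subst)
open import Relation.Nullary.Decidable.Core using (yes; no)
open import Relation.Nullary.Negation.Core using (¬_)
open import Relation.Unary using (Pred)

open Poset using (Carrier)

-- Composition and factorisation of quotient maps

module Quotient {A B : Pos} (φ : QuotientMap A B) where
  open IsQuotientMap (QuotientMap.isQuotientMap φ) public
  open IsOrderHomomorphism isOrderHomomorphism public using (cong; mono)

  section : Carrier B → Carrier A
  section b = proj₁ (surjective b)

  section-inverse : ∀ b → Poset._≈_ B (⟦ φ ⟧ (section b)) b
  section-inverse b = proj₂ (surjective b) (Poset.Eq.refl A)

infixr 9 _∘q_

_∘q_ : ∀ {A B C} → QuotientMap B C → QuotientMap A B → QuotientMap A C
_∘q_ {A} {B} {C} ψ φ = record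
  { ⟦_⟧ = ⟦ ψ ⟧ ∘ ⟦ φ ⟧
  ; isQuotientMap = record
    { isOrderHomomorphism = record { cong = ψ.cong ∘ φ.cong ; mono = ψ.mono ∘ φ.mono }
    ; surjective = λ c →
        φ.section (ψ.section c) ,
        λ z≈ → C.trans (ψ.cong (B.trans (φ.cong z≈) (φ.section-inverse _))) (ψ.section-inverse c)
    ; lifts-≤ = λ p≤r →
        let b , b′ , b≤b′ , ψb≈p , ψb′≈r = ψ.lifts-≤ p≤r
            a , a′ , a≤a′ , φa≈b , φa′≈b′ = φ.lifts-≤ b≤b′
        in a , a′ , a≤a′ , C.trans (ψ.cong φa≈b) ψb≈p , C.trans (ψ.cong φa′≈b′) ψb′≈r
    }
  }
  where
  module φ = Quotient φ
  module ψ = Quotient ψ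
  module B = Poset.Eq B
  module C = Poset.Eq C

-- The map is `h` after a section of `q`. The section need not respect `_≈_`, but the kernel
-- condition makes its choices invisible to `h`. For monotonicity, a comparable pair in `B` is first
-- lifted through `q` to a comparable pair in `A`.
factorise : ∀ {A B C} (q : QuotientMap A B) (h : QuotientMap A C) →
            (∀ x y → Poset._≈_ B (⟦ q ⟧ x) (⟦ q ⟧ y) → Poset._≈_ C (⟦ h ⟧ x) (⟦ h ⟧ y)) →
            Σ (QuotientMap B C) λ k → ∀ x → Poset._≈_ C (⟦ k ⟧ (⟦ q ⟧ x)) (⟦ h ⟧ x)
factorise {A} {B} {C} q h kernel = record
  { ⟦_⟧ = k
  ; isQuotientMap = record
    { isOrderHomomorphism = record { cong = k-cong ; mono = k-mono }
    ; surjective = λ c →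
        ⟦ q ⟧ (h.section c) ,
        λ z≈ → C.Eq.trans (k-cong z≈) (C.Eq.trans (k∘q≈h _) (h.section-inverse c))
    ; lifts-≤ = λ p≤r →
        let x , y , x≤y , hx≈p , hy≈r = h.lifts-≤ p≤r
        in ⟦ q ⟧ x , ⟦ q ⟧ y , q.mono x≤y ,
           C.Eq.trans (k∘q≈h x) hx≈p , C.Eq.trans (k∘q≈h y) hy≈r
    }
  } , k∘q≈h
  where
  module q = Quotient q
  module h = Quotient h
  module B = Poset B
  module C = Poset C

  k : B.Carrier → C.Carrier
  k = ⟦ h ⟧ ∘ q.section

  k∘q≈h : ∀ x → k (⟦ q ⟧ x) C.≈ ⟦ h ⟧ x
  k∘q≈h x = kernel _ _ (q.section-inverse (⟦ q ⟧ x))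

  k-cong : ∀ {b b′} → b B.≈ b′ → k b C.≈ k b′
  k-cong b≈b′ = kernel _ _
    (B.Eq.trans (q.section-inverse _) (B.Eq.trans b≈b′ (B.Eq.sym (q.section-inverse _))))

  k-mono : ∀ {b b′} → b B.≤ b′ → k b C.≤ k b′
  k-mono b≤b′ =
    let x , y , x≤y , qx≈b , qy≈b′ = q.lifts-≤ b≤b′
    in C.trans (C.reflexive (C.Eq.trans (k-cong (B.Eq.sym qx≈b)) (k∘q≈h x)))
      (C.trans (h.mono x≤y)
               (C.reflexive (C.Eq.trans (C.Eq.sym (k∘q≈h y)) (k-cong qy≈b′))))

subposet : (A : Pos) → Pred (Carrier A) 0ℓ → Pos
subposet A C = On.poset {B = ∃ C} A proj₁

-- Pullbacks of quotient maps

module _ {A B C : Pos} (f : QuotientMap A C) (g : QuotientMap B C) where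
  private
    module f = Quotient f
    module g = Quotient g
    module A = Poset A
    module B = Poset B
    module C = Poset C

  Matching : Pred (A.Carrier × B.Carrier) 0ℓ
  Matching (a , b) = ⟦ f ⟧ a C.≈ ⟦ g ⟧ b

  Matching-respects-≈ : Matching Respects Poset._≈_ (×-poset A B)
  Matching-respects-≈ (a≈a′ , b≈b′) fa≈gb =
    C.Eq.trans (f.cong (A.Eq.sym a≈a′)) (C.Eq.trans fa≈gb (g.cong b≈b′))

  pullback : Pos
  pullback = subposet (×-poset A B) Matching

  -- A pair `a ≤ a′` is pushed down by `f` and lifted through `g`; the lifted pair matches `a` and
  -- `a′` over `C`, so the lifting property of `g` passes to the opposite projection.
  pullback-π₁ : QuotientMap pullback A
  pullback-π₁ = record
    { ⟦_⟧ = proj₁ ∘ proj₁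
    ; isQuotientMap = record
      { isOrderHomomorphism = record { cong = proj₁ ; mono = proj₁ }
      ; surjective = λ a →
          ((a , g.section (⟦ f ⟧ a)) , C.Eq.sym (g.section-inverse _)) , proj₁
      ; lifts-≤ = λ {a} {a′} a≤a′ →
          let b , b′ , b≤b′ , gb≈fa , gb′≈fa′ = g.lifts-≤ (f.mono a≤a′)
          in ((a , b) , C.Eq.sym gb≈fa) , ((a′ , b′) , C.Eq.sym gb′≈fa′) ,
             (a≤a′ , b≤b′) , A.Eq.refl , A.Eq.refl
      }
    }

  pullback-π₂ : QuotientMap pullback B
  pullback-π₂ = record
    { ⟦_⟧ = proj₂ ∘ proj₁
    ; isQuotientMap = record
      { isOrderHomomorphism = record { cong = proj₂ ; mono = proj₂ }
      ; surjective = λ b →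
          ((f.section (⟦ g ⟧ b) , b) , f.section-inverse _) , proj₂
      ; lifts-≤ = λ {b} {b′} b≤b′ →
          let a , a′ , a≤a′ , fa≈gb , fa′≈gb′ = f.lifts-≤ (g.mono b≤b′)
          in ((a , b) , fa≈gb) , ((a′ , b′) , fa′≈gb′) ,
             (a≤a′ , b≤b′) , B.Eq.refl , B.Eq.refl
      }
    }

-- Finite posets

unique⇒lookup-injective : ∀ (S : Setoid 0ℓ 0ℓ) {xs} → Unique.Unique S xs →
  ∀ i j → Setoid._≈_ S (lookup xs i) (lookup xs j) → i ≡ j
unique⇒lookup-injective S (_ ∷ _) zero zero _ = refl
unique⇒lookup-injective S (x∉xs ∷ _) zero (suc j) x≈y =
  ⊥-elim (All.lookup x∉xs (∈-lookup j) x≈y)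
unique⇒lookup-injective S (x∉xs ∷ _) (suc i) zero y≈x =
  ⊥-elim (All.lookup x∉xs (∈-lookup i) (Setoid.sym S y≈x))
unique⇒lookup-injective S (_ ∷ xs!) (suc i) (suc j) x≈y =
  cong suc (unique⇒lookup-injective S xs! i j x≈y)

-- Repetitions are allowed, so enumerations pass easily to products and subsets; the bijection
-- demanded by `Finite` is restored once, at the end.
Enumerable : Pos → Set
Enumerable A = ∃ (IsEnumeration (Poset.Eq.setoid A))

Finite⇒Enumerable : (A : Pos) → Finite A → Enumerable A
Finite⇒Enumerable A (n , inv) =
  map (Inverse.to inv) (allFin n) ,
  Enumerates.map⁺ (setoid (Fin n)) (Poset.Eq.setoid A)
    (Bijection.surjection (Inverse⇒Bijection inv)) ∈-allFin

×-enumerable : (A B : Pos) → Enumerable A → Enumerable B → Enumerable (×-poset A B)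
×-enumerable A B (xs , _∈xs) (ys , _∈ys) =
  cartesianProduct xs ys ,
  Enumerates.cartesianProduct⁺ (Poset.Eq.setoid A) (Poset.Eq.setoid B) _∈xs _∈ys

module _ (em : ExcludedMiddle 0ℓ) where

  -- Excluded middle decides `_≈_`, so duplicates can be deleted; indexing into the resulting list
  -- is then a bijection.
  Enumerable⇒Finite : (A : Pos) → Enumerable A → Finite A
  Enumerable⇒Finite A (xs , _∈xs) = _ , Bijection⇒Inverse (record
    { to = lookup ys
    ; cong = λ { refl → Poset.Eq.refl A }
    ; bijective = unique⇒lookup-injective S (deduplicate-! S? xs) _ _ ,
                  Enumerates.lookup-surjective S (Enumerates.deduplicate⁺ S? _∈xs)
    })
    where
    S : Setoid 0ℓ 0ℓ
    S = Poset.Eq.setoid A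

    S? : DecSetoid 0ℓ 0ℓ
    S? = record
      { isDecEquivalence = record { isEquivalence = Setoid.isEquivalence S ; _≟_ = λ _ _ → em } }

    ys : List (Carrier A)
    ys = deduplicate (DecSetoid._≟_ S?) xs

  subposet-enumerable : (A : Pos) (C : Pred (Carrier A) 0ℓ) → C Respects Poset._≈_ A →
                        Enumerable A → Enumerable (subposet A C)
  subposet-enumerable A C resp (xs , _∈xs) =
    let ys , covers = restrict xs in ys , λ y → covers y (proj₁ y ∈xs)
    where
    open Membership (Poset.Eq.setoid A) using (_∈_)
    open Membership (Poset.Eq.setoid (subposet A C)) using () renaming (_∈_ to _∈ₛ_)

    restrict : ∀ xs → ∃ λ ys → ∀ y → proj₁ y ∈ xs → y ∈ₛ ys
    restrict [] = [] , λ _ ()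
    restrict (x ∷ xs) with restrict xs | em {C x}
    ... | ys , covers | yes c = (x , c) ∷ ys , λ where
      y (here y≈x)   → here y≈x
      y (there y∈xs) → there (covers y y∈xs)
    ... | ys , covers | no ¬c = ys , λ where
      y (here y≈x)   → ⊥-elim (¬c (resp y≈x (proj₂ y)))
      y (there y∈xs) → covers y y∈xs

  pullback-finite : ∀ {A B C} (f : QuotientMap A C) (g : QuotientMap B C) →
                    Finite A → Finite B → Finite (pullback f g)
  pullback-finite {A} {B} f g finA finB = Enumerable⇒Finite (pullback f g)
    (subposet-enumerable (×-poset A B) (Matching f g) (Matching-respects-≈ f g)
      (×-enumerable A B (Finite⇒Enumerable A finA) (Finite⇒Enumerable B finB)))

uniform-bound : ∀ n (Q : Fin n → ℕ → Set) → (∀ i {M M′} → M ≤ M′ → Q i M → Q i M′) →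
                (∀ i → ∃ (Q i)) → ∃ λ M → ∀ i → Q i M
uniform-bound zero Q mono bounds = 0 , λ ()
uniform-bound (suc n) Q mono bounds =
  let M , q = bounds zero
      M′ , qs = uniform-bound n (Q ∘ suc) (mono ∘ suc) (bounds ∘ suc)
  in M ⊔ M′ , λ where
    zero    → mono zero (m≤m⊔n M M′) q
    (suc i) → mono (suc i) (m≤n⊔m M M′) (qs i)

-- Inverse limits

module InverseLimit (S : InverseSequence) where
  open InverseSequence S
  private
    module P n = Poset (P n)
    module p {k m} (k<m : k < m) = Quotient (p k<m)

  𝕃 : Pos
  𝕃 = limit S

  -- The bonding maps depend on a proof of `_<_`; irrelevance of such proofs frees the composition
  -- law from the particular proof `<-trans`.
  p-comp′ : ∀ {l k m} (l<k : l < k) (k<m : k < m) (l<m : l < m) x →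
            P._≈_ l (⟦ p l<k ⟧ (⟦ p k<m ⟧ x)) (⟦ p l<m ⟧ x)
  p-comp′ l<k k<m l<m x rewrite <-irrelevant l<m (<-trans l<k k<m) = p-comp l<k k<m x

  thread-p : (x : Thread S) → ∀ {k m} (k<m : k < m) →
             P._≈_ k (⟦ p k<m ⟧ (proj₁ x m)) (proj₁ x k)
  thread-p x {k} {suc m} k<1+m with m<1+n⇒m<n∨m≡n k<1+m
  ... | inj₁ k<m = P.Eq.trans k (P.Eq.sym k (p-comp′ k<m (n<1+n m) k<1+m _))
                  (P.Eq.trans k (p.cong k<m (proj₂ x m)) (thread-p x k<m))
  ... | inj₂ refl rewrite <-irrelevant k<1+m (n<1+n k) = proj₂ x k

  agree-below : (x y : Thread S) → ∀ {k m} → k ≤ m →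
                P._≈_ m (proj₁ x m) (proj₁ y m) → P._≈_ k (proj₁ x k) (proj₁ y k)
  agree-below x y {k} k≤m x≈y with m≤n⇒m<n∨m≡n k≤m
  ... | inj₁ k<m = P.Eq.trans k (P.Eq.sym k (thread-p x k<m))
                  (P.Eq.trans k (p.cong k<m x≈y) (thread-p y k<m))
  ... | inj₂ refl = x≈y

  -- Threads with a prescribed coordinate

  module _ (N : ℕ) where

    record Ray : Set where
      field
        node     : ∀ j → P.Carrier (j + N)
        coherent : ∀ j → P._≈_ (j + N) (⟦ p (n<1+n (j + N)) ⟧ (node (suc j))) (node j)
    open Ray

    private
      below : ∀ n → n < suc n + N
      below n = m≤m+n (suc n) N

    ray-p : (u : Ray) → ∀ j (N<j+N : N < suc j + N) →
            P._≈_ N (⟦ p N<j+N ⟧ (node u (suc j))) (node u 0)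
    ray-p u zero lt rewrite <-irrelevant lt (n<1+n N) = coherent u 0
    ray-p u (suc j) lt =
      P.Eq.trans N (P.Eq.sym N (p-comp′ N<j+N (n<1+n _) lt _))
     (P.Eq.trans N (p.cong N<j+N (coherent u (suc j))) (ray-p u j N<j+N))
      where
      N<j+N : N < suc j + N
      N<j+N = s≤s (m≤n+m N j)

    -- Coordinate `n` is the image of the node at level `suc n + N`. This level is strictly above
    -- `n` on either side of `N`, so no case distinction is needed and the strict bonding maps
    -- suffice.
    thread : Ray → Thread S
    thread u = (λ n → ⟦ p (below n) ⟧ (node u (suc n))) , λ n →
      P.Eq.trans n (p-comp′ (n<1+n n) (below (suc n)) (<-trans (below n) (n<1+n _)) _)
     (P.Eq.trans n (P.Eq.sym n (p-comp′ (below n) (n<1+n _) _ _))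
                   (p.cong (below n) (coherent u (suc n))))

    thread-at : (u : Ray) → P._≈_ N (proj₁ (thread u) N) (node u 0)
    thread-at u = ray-p u N (below N)

    thread-mono : (u w : Ray) → (∀ j → P._≤_ (j + N) (node u j) (node w j)) →
                  Poset._≤_ 𝕃 (thread u) (thread w)
    thread-mono u w u≤w n = p.mono (below n) (u≤w (suc n))

    -- Both rays are built in one recursion, since `lifts-≤` lifts a comparable pair as a whole and
    -- two separate lifts need not be comparable.
    lift-pair : ∀ {v w} → P._≤_ N v w →
                Σ Ray λ r → Σ Ray λ s → (∀ j → P._≤_ (j + N) (node r j) (node s j)) ×
                node r 0 ≡ v × node s 0 ≡ w
    lift-pair {v} {w} v≤w =
      record { node = proj₁ ∘ pair ; coherent = λ j → proj₁ (proj₂ (proj₂ (proj₂ (next j)))) } ,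
      record { node = λ j → proj₁ (proj₂ (pair j))
             ; coherent = λ j → proj₂ (proj₂ (proj₂ (proj₂ (next j)))) } ,
      (λ j → proj₂ (proj₂ (pair j))) , refl , refl
      where
      -- `next` also carries the coherence proofs; `pair` omits them because the starting pair has
      -- nothing below it to cohere with.
      pair : ∀ j → ∃ λ v → ∃ λ w → P._≤_ (j + N) v w

      next : ∀ j → ∃ λ v → ∃ λ w → P._≤_ (suc j + N) v w ×
             P._≈_ (j + N) (⟦ p (n<1+n _) ⟧ v) (proj₁ (pair j)) ×
             P._≈_ (j + N) (⟦ p (n<1+n _) ⟧ w) (proj₁ (proj₂ (pair j)))

      pair zero = v , w , v≤w
      pair (suc j) = let v′ , w′ , v′≤w′ , _ = next j in v′ , w′ , v′≤w′

      next j = p.lifts-≤ (n<1+n (j + N)) (proj₂ (proj₂ (pair j)))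

    π : QuotientMap 𝕃 (P N)
    π = record
      { ⟦_⟧ = λ x → proj₁ x N
      ; isQuotientMap = record
        { isOrderHomomorphism = record { cong = λ x≈y → x≈y N ; mono = λ x≤y → x≤y N }
        -- A preimage of `v` comes from lifting the reflexive pair `v ≤ v`.
        ; surjective = λ v →
            let x , _ , _ , x≈v , _ = lift (P.refl N)
            in x , λ z≈x → P.Eq.trans N (z≈x N) x≈v
        ; lifts-≤ = lift
        }
      }
      where
      lift : ∀ {v w} → P._≤_ N v w → ∃ λ x → ∃ λ y →
             Poset._≤_ 𝕃 x y × P._≈_ N (proj₁ x N) v × P._≈_ N (proj₁ y N) w
      lift v≤w with lift-pair v≤w
      ... | r , s , r≤s , refl , refl =
        thread r , thread s , thread-mono r s r≤s , thread-at r , thread-at s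

  -- Continuity on the limit

  factors⇒continuous : ∀ {B} N (k : QuotientMap (P N) B) →
                       Continuous (limitTopology S) (discrete B) ⟦ k ∘q π N ⟧
  factors⇒continuous N k U U-resp =
    (λ x → U (⟦ k ⟧ (x N))) ,
    (λ x Ux → N ∷ [] , W ,
      (λ { n v≈w Wv refl → U-resp (Quotient.cong k v≈w) (Wv refl) }) ,
      (λ { refl → Ux }) ∷ [] ,
      λ { y (Wy ∷ []) → Wy refl }) ,
    λ x → mk⇔ (λ u → u) (λ u → u)
    where
    -- The guard `n ≡ N` leaves every coordinate other than `N` unconstrained, without deciding
    -- equality of indices.
    W : ∀ n → Pred (P.Carrier n) 0ℓ
    W n v = (eq : n ≡ N) → U (⟦ k ⟧ (subst P.Carrier eq v))

  -- The fibre of `f` through `x` is open, so it contains a basic neighbourhood constraining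
  -- finitely many coordinates; in a thread the highest of these determines the others.
  continuous⇒locallyConstant :
    ∀ {A} (f : QuotientMap 𝕃 A) → Continuous (limitTopology S) (discrete A) ⟦ f ⟧ →
    ∀ x → ∃ λ N → ∀ y → P._≈_ N (proj₁ y N) (proj₁ x N) → Poset._≈_ A (⟦ f ⟧ y) (⟦ f ⟧ x)
  continuous⇒locallyConstant {A} f cont x
    with cont (λ a → Poset._≈_ A a (⟦ f ⟧ x)) (λ a≈b a≈fx → A.trans (A.sym a≈b) a≈fx)
    where module A = Poset.Eq A
  ... | V , V-open , iff
    with V-open (proj₁ x) (Equivalence.to (iff x) (Poset.Eq.refl A))
  ... | F , W , W-resp , Wx , W⊆V =
    -- The default 0 is the level chosen when `F` is empty.
    max 0 F , λ y y≈x → Equivalence.from (iff y) (W⊆V (proj₁ y)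
      (All.zipWith
        (λ { {n} (n≤N , w) → W-resp n (P.Eq.sym n (agree-below y x n≤N y≈x)) w })
        (xs≤max 0 F , Wx)))

  -- Compactness by König's lemma

  module Compactness (em : ExcludedMiddle 0ℓ) {A : Pos} (f : QuotientMap 𝕃 A)
    (cont : Continuous (limitTopology S) (discrete A) ⟦ f ⟧) where
    private module A = Poset A

    Decides : ℕ → Pred (Thread S) 0ℓ → Set
    Decides M D = ∀ x y → D x → P._≈_ M (proj₁ x M) (proj₁ y M) → ⟦ f ⟧ x A.≈ ⟦ f ⟧ y

    cone : ∀ n → P.Carrier n → Pred (Thread S) 0ℓ
    cone n v x = P._≈_ n (proj₁ x n) v

    -- Bad nodes play the role of the nodes with infinitely many descendants in König's lemma.
    Bad : ∀ n → Pred (P.Carrier n) 0ℓ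
    Bad n v = ¬ ∃ λ M → Decides M (cone n v)

    -- If no node in `C` is bad, each has a level of its own, and the maximum over the finite level
    -- `n` serves them all. A general `C` covers both the children of a node and the whole of level
    -- 0.
    bad-or-bounded : ∀ n (C : Pred (P.Carrier n) 0ℓ) → C Respects P._≈_ n →
                     (∃ λ v → C v × Bad n v) ⊎ (∃ λ M → Decides M (λ x → C (proj₁ x n)))
    bad-or-bounded n C resp with em {∃ λ v → C v × Bad n v} | finite n
    ... | yes bad | _ = inj₁ bad
    ... | no ¬bad | m , inv =
      let M , d = uniform-bound m (λ i M → C (to i) → Decides M (cone n (to i))) weaken bounds
      -- The enumeration returns the coordinate of `x` only up to `_≈_`, hence the demand that `C`
      -- respect it.
      in inj₂ (M , λ x y Cx → d (from (proj₁ x n))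
                 (resp (P.Eq.sym n (to-from (proj₁ x n))) Cx) x y
                 (P.Eq.sym n (to-from (proj₁ x n))))
      where
      open Inverse inv using (to; from) renaming (strictlyInverseˡ to to-from)

      weaken : ∀ i {M M′} → M ≤ M′ → (C (to i) → Decides M (cone n (to i))) →
               C (to i) → Decides M′ (cone n (to i))
      weaken i M≤M′ d c x y x∈ x≈y = d c x y x∈ (agree-below x y M≤M′ x≈y)

      bounds : ∀ i → ∃ λ M → C (to i) → Decides M (cone n (to i))
      bounds i with em {∃ λ M → Decides M (cone n (to i))}
      ... | yes (M , d) = M , λ _ → d
      -- The level 0 is arbitrary: `to i` is bad, so it cannot lie in `C`.
      ... | no bad = 0 , λ c → ⊥-elim (¬bad (to i , c , bad))

    -- Every thread through `v` passes through a child of `v`, so a common level for all children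
    -- would also serve `v`, which is bad.
    bad-child : ∀ n (v : ∃ (Bad n)) → ∃ λ w → P._≈_ n (⟦ p (n<1+n n) ⟧ w) (proj₁ v) × Bad (suc n) w
    bad-child n (v , bad)
      with bad-or-bounded (suc n) (λ w → P._≈_ n (⟦ p (n<1+n n) ⟧ w) v)
             (λ w≈w′ pw≈v → P.Eq.trans n (p.cong (n<1+n n) (P.Eq.sym (suc n) w≈w′)) pw≈v)
    ... | inj₁ child = child
    ... | inj₂ (M , d) = ⊥-elim (bad (M , λ x y x≈v → d x y (P.Eq.trans n (proj₂ x n) x≈v)))

    -- Otherwise some thread consists of bad nodes, yet f is constant on one of its cones.
    root-not-bad : ∀ v → ¬ Bad 0 v
    root-not-bad v bad =
      let N , const = continuous⇒locallyConstant f cont x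
      in proj₂ (branch N) (N , λ y z y≈x y≈z →
           A.Eq.trans (const y y≈x)
             (A.Eq.sym (const z (P.Eq.trans N (P.Eq.sym N y≈z) y≈x))))
      where
      branch : ∀ n → ∃ (Bad n)
      branch zero    = v , bad
      branch (suc n) = let w , _ , bad′ = bad-child n (branch n) in w , bad′

      x : Thread S
      x = proj₁ ∘ branch , λ n → proj₁ (proj₂ (bad-child n (branch n)))

    -- Level 0 may have several nodes, so the tree has no single root; the dichotomy is applied to
    -- all of `P 0` at once.
    uniformly-decided : ∃ λ N → ∀ x y → P._≈_ N (proj₁ x N) (proj₁ y N) →
                        ⟦ f ⟧ x A.≈ ⟦ f ⟧ y
    uniformly-decided with bad-or-bounded 0 (λ _ → ⊤) (λ _ _ → tt)
    ... | inj₁ (v , _ , bad) = ⊥-elim (root-not-bad v bad)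
    ... | inj₂ (N , d) = N , λ x y → d x y tt

mainTheorem8 : ExcludedMiddle 0ℓ →
    (S : InverseSequence) → IsFraïssé S →
    (A B : Pos) → Finite A → Finite B →
    (f : QuotientMap (limit S) A) →
    Continuous (limitTopology S) (discrete A) ⟦ f ⟧ →
    (g : QuotientMap B A) →
    Σ (QuotientMap (limit S) B) λ h →
    Continuous (limitTopology S) (discrete B) ⟦ h ⟧ ×
    (∀ x → Poset._≈_ A (⟦ g ⟧ (⟦ h ⟧ x)) (⟦ f ⟧ x))
mainTheorem8 em S fraïssé A B finA finB f cont g =
  let N , kernel = Compactness.uniformly-decided em f cont
      f′ , f′∘π≈f = factorise (π N) f kernel
      l , N<l , k , π₁∘k≈p =
        IsFraïssé.amalgamation fraïssé N (pullback f′ g)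
          (pullback-finite em f′ g (finite N) finB) (pullback-π₁ f′ g)
      h = pullback-π₂ f′ g ∘q k
  in h ∘q π l , factors⇒continuous l h , λ x →
       -- The matching condition of the pullback replaces `g` after its second projection by `f′`
       -- after its first; amalgamation and the thread condition then reduce this to `f′` at
       -- coordinate `N`.
       A.trans (A.sym (proj₂ (⟦ k ⟧ (proj₁ x l))))
      (A.trans (Quotient.cong f′ (Poset.Eq.trans (P N) (π₁∘k≈p _) (thread-p x N<l)))
               (f′∘π≈f x))
  where
  open InverseSequence S
  open InverseLimit S
  module A = Poset.Eq A
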